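{- Fix an integer $t\geq 6$ and a nonnegative integer $\delta$. Assume that every $K_{t+1}$-minor-free graph has minimum degree at most $\delta$. Then every $K_{t+1}$-minor-free graph $G$ satisfies $$\chi(G)\leq \delta- \frac{2\delta -5}{4t - 14}+\frac{3}{2}$$ and $$\chi(G)\leq\delta\left(1-\frac{1}{(2-\gamma)(t-1)}\right)+2,$$ where $\gamma= (80-\sqrt{5392})/126 \approx 0.0521$.
   Context: All graphs are finite and simple. A graph is $K_s$-minor-free if the complete graph $K_s$ is not a minor of it. $\chi(G)$ denotes the chromatic number of $G$, the least $k$ such that the vertices of $G$ can be coloured with $k$ colours with adjacent vertices receiving different colours. -}

module Defs where

open import Data.Nat using (ℕ; zero; suc; _≤_)
open import Data.Fin using (Fin)
open import Data.Bool using (Bool; true; false; if_then_else_)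
open import Data.Maybe using (Maybe; just)
open import Data.List using (List; map; allFin)
open import Data.Nat.ListAction using (sum)
open import Data.Empty using (⊥)
open import Data.Product using (Σ; ∃; ∃-syntax; _×_; _,_)
open import Data.Sum using (_⊎_)
open import Data.Integer as ℤ using (ℤ; +_)
open import Relation.Binary.PropositionalEquality using (_≡_; _≢_)

record Graph (n : ℕ) : Set where
  field
    adj    : Fin n → Fin n → Bool
    sym    : ∀ u v → adj u v ≡ adj v u
    irrefl : ∀ v → adj v v ≡ false
open Graph public

degree : ∀ {n} → Graph n → Fin n → ℕ
degree {n} G v = sum (map (λ u → if adj G v u then 1 else 0) (allFin n))

data Walk {n : ℕ} (G : Graph n) (P : Fin n → Set) : Fin n → Fin n → Set where
  here : ∀ {u} → P u → Walk G P u u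
  step : ∀ {u w v} → P u → adj G u w ≡ true → Walk G P w v → Walk G P u v

-- A K_s minor model: disjoint nonempty connected branch sets B_i (vertices
-- mapped to nothing are deleted), with an edge between any two distinct branch sets.
record KMinor {n : ℕ} (G : Graph n) (s : ℕ) : Set where
  field
    branch    : Fin n → Maybe (Fin s)
    nonempty  : ∀ i → ∃[ v ] branch v ≡ just i
    connected : ∀ i u v → branch u ≡ just i → branch v ≡ just i →
                Walk G (λ x → branch x ≡ just i) u v
    adjacent  : ∀ i j → i ≢ j → ∃[ u ] ∃[ v ]
                (branch u ≡ just i × branch v ≡ just j × adj G u v ≡ true)

KMinorFree : ∀ {n} → Graph n → ℕ → Set
KMinorFree G s = KMinor G s → ⊥

Colourable : ∀ {n} → Graph n → ℕ → Set
Colourable {n} G k = Σ (Fin n → Fin k) λ c → ∀ u v → adj G u v ≡ true → c u ≢ c v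

-- Bound 1, cleared of denominators (multiply by 2(4t-14) > 0):
--   k ≤ δ - (2δ-5)/(4t-14) + 3/2
Bound1 : ℕ → ℕ → ℕ → Set
Bound1 t δ k = (+ 2 ℤ.* (+ 4 ℤ.* + t ℤ.- + 14)) ℤ.* + k
           ℤ.≤ (+ 2 ℤ.* (+ 4 ℤ.* + t ℤ.- + 14)) ℤ.* + δ
               ℤ.- + 2 ℤ.* (+ 2 ℤ.* + δ ℤ.- + 5)
               ℤ.+ + 3 ℤ.* (+ 4 ℤ.* + t ℤ.- + 14)

-- Bound 2: k ≤ δ(1 - 1/((2-γ)(t-1))) + 2 with γ = (80 - √5392)/126.
-- Since 1/(2-γ) = (172 - √5392)/192, multiplying by 192(t-1) > 0 this is
--   A ≤ δ√5392   where  A = 192(t-1)(k-2-δ) + 172δ,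
-- i.e. A ≤ 0 or A² ≤ 5392 δ².
Bound2A : ℕ → ℕ → ℕ → ℤ
Bound2A t δ k = + 192 ℤ.* (+ t ℤ.- + 1) ℤ.* (+ k ℤ.- + 2 ℤ.- + δ) ℤ.+ + 172 ℤ.* + δ

Bound2 : ℕ → ℕ → ℕ → Set
Bound2 t δ k = (Bound2A t δ k ℤ.≤ + 0)
             ⊎ (Bound2A t δ k ℤ.* Bound2A t δ k ℤ.≤ + 5392 ℤ.* (+ δ ℤ.* + δ))

{-# OPTIONS --safe #-}
module Submission where

-- By induction on the order of G we colour G with k = δ + 1 - j colours, where
-- j = ⌊(δ - 1)/(t - 1)⌋; this is at most both bounds.  Let v have degree at most δ,
-- and let S be an independent set of neighbours of v.  Contracting S ∪ {v} and
-- colouring the result gives a k-colouring of G - v in which S is monochromatic.  If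
-- some colour is missing around v, colour v with it.  Otherwise let X be the set of
-- neighbours of v whose colour occurs only once around v.  Two vertices of X are joined
-- by a Kempe chain in their two colours, since otherwise swapping the colours along the
-- chain frees a colour for v.  Hence disjoint subsets of X lie in disjoint connected
-- subgraphs of G - v, and a K_t minor rooted in N(v) only needs pairwise adjacent subsets.
-- Take the classes of a Grundy colouring of X: if it has t classes, or if it has t - 1
-- and some vertex of S sees all of them, then together with v there is a K_{t+1} minor.
-- Otherwise X ∪ S has a (t - 1)-colouring.  Either one of its classes is larger than S,
-- and replaces S, or |X ∪ S| ≤ (t - 1)|S|, which contradicts the count
-- |X ∪ S| + deg v ≥ 2(k - 1) + 2|S| together with |S| ≤ j.

open import Defs
open import Data.Nat using (ℕ; zero; suc; _+_; _*_; _∸_; _/_; _%_; _≤_; _<_; z≤n; s≤s; z<s; _<?_)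
open import Data.Nat.Properties hiding (_≟_; <-cmp)
import Data.Nat.Properties as ℕₚ
open import Data.Nat.DivMod using (m≡m%n+[m/n]*n; m%n<n; m/n≤m; m/n*n≤m)
open import Data.Nat.Induction using (<-rec)
import Data.Nat.ListAction as ListAction
import Data.Nat.Tactic.RingSolver as ℕ-Ring
import Data.Integer as ℤ
import Data.Integer.Properties as ℤₚ
import Data.Integer.Tactic.RingSolver as ℤ-Ring
open import Data.Fin using (Fin; zero; suc; toℕ; fromℕ<)
import Data.Fin as Fin
open import Data.Fin.Properties using (_≟_; any?; all?; ¬∀⟶∃¬; <-cmp; toℕ-injective; toℕ<n; toℕ-fromℕ<)
open import Data.Bool using (Bool; true; false; if_then_else_)
import Data.Bool.Properties as Boolₚ
open import Data.Maybe using (Maybe; just; nothing)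
open import Data.Maybe.Properties using (just-injective; ≡-dec)
open import Data.List as List using (List; length; lookup; filter; allFin; tabulate)
open import Data.List.Properties using (filter-notAll; length-tabulate; map-tabulate)
open import Data.List.Relation.Unary.All as All using ()
open import Data.List.Relation.Unary.AllPairs using (_∷_)
import Data.List.Relation.Unary.Any as Any
open import Data.List.Relation.Unary.Any.Properties using (lookup-index)
open import Data.List.Relation.Unary.Unique.Propositional using (Unique)
open import Data.List.Relation.Unary.Unique.Propositional.Properties using (allFin⁺; filter⁺)
open import Data.List.Membership.Propositional using (_∈_; lose)
open import Data.List.Membership.Propositional.Properties using (∈-lookup; ∈-allFin; ∈-filter⁺; ∈-filter⁻)
open import Data.Product using (Σ; ∃; ∃-syntax; _×_; _,_; proj₁; proj₂)
open import Data.Sum using (_⊎_; inj₁; inj₂; [_,_]′)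
open import Data.Empty using (⊥)
open import Function using (_∘_; id; mk⇔)
open import Relation.Nullary using (¬_; Dec; yes; no; does; contradiction)
open import Relation.Nullary.Decidable using (_×-dec_; _⊎-dec_; _→-dec_; ¬?; does-⇔; dec-true; dec-false; decidable-stable)
open import Relation.Unary using (Decidable)
open import Relation.Binary.Definitions using (tri<; tri≈; tri>)
open import Relation.Binary.PropositionalEquality using (_≡_; _≢_; refl; trans; cong; cong₂; subst; module ≡-Reasoning) renaming (sym to ≡-sym)
open import Algebra.Properties.CommutativeMonoid.Sum +-0-commutativeMonoid using (sum; sum-cong-≗; ∑-comm; ∑-distrib-+)

private variable
  n k s : ℕ

-- Finite sums and cardinalities of decidable sets.

does-true⇒ : ∀ {A : Set} (a? : Dec A) → does a? ≡ true → A
does-true⇒ (yes a) _ = a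

sum-mono : {f g : Fin n → ℕ} → (∀ i → f i ≤ g i) → sum f ≤ sum g
sum-mono {zero}  f≤g = z≤n
sum-mono {suc n} f≤g = +-mono-≤ (f≤g zero) (sum-mono (f≤g ∘ suc))

sum-mono-< : {f g : Fin n → ℕ} → (∀ i → f i ≤ g i) → ∀ i → f i < g i → sum f < sum g
sum-mono-< f≤g zero    lt = +-mono-<-≤ lt (sum-mono (f≤g ∘ suc))
sum-mono-< f≤g (suc i) lt = +-mono-≤-< (f≤g zero) (sum-mono-< (f≤g ∘ suc) i lt)

sum-upper : ∀ (f : Fin n → ℕ) {y} → (∀ i → f i ≤ y) → sum f ≤ n * y
sum-upper {zero}  f f≤y = z≤n
sum-upper {suc n} f f≤y = +-mono-≤ (f≤y zero) (sum-upper (f ∘ suc) (f≤y ∘ suc))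

sum-lower : ∀ (f : Fin n → ℕ) {x} → (∀ i → x ≤ f i) → n * x ≤ sum f
sum-lower {zero}  f x≤f = z≤n
sum-lower {suc n} f x≤f = +-mono-≤ (x≤f zero) (sum-lower (f ∘ suc) (x≤f ∘ suc))

sum-lower-except : ∀ (f : Fin (suc n) → ℕ) {x y} j →
  (∀ i → i ≢ j → x ≤ f i) → y ≤ f j → n * x + y ≤ sum f
sum-lower-except {n} f {x} {y} zero x≤f y≤f =
  subst (_≤ sum f) (+-comm y (n * x))
    (+-mono-≤ y≤f (sum-lower (f ∘ suc) (λ i → x≤f (suc i) λ ())))
sum-lower-except {suc n} f {x} {y} (suc j) x≤f y≤f =
  subst (_≤ sum f) (≡-sym (+-assoc x (n * x) y))
    (+-mono-≤ (x≤f zero λ ())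
      (sum-lower-except (f ∘ suc) j (λ i i≢j → x≤f (suc i) λ { refl → i≢j refl }) y≤f))

indicator : Bool → ℕ
indicator b = if b then 1 else 0

indicator≤1 : ∀ b → indicator b ≤ 1
indicator≤1 false = z≤n
indicator≤1 true  = ≤-refl

indicator-mono : ∀ {A B : Set} (a? : Dec A) (b? : Dec B) → (A → B) →
  indicator (does a?) ≤ indicator (does b?)
indicator-mono (no _)  _       _ = z≤n
indicator-mono (yes a) (yes _) _ = ≤-refl
indicator-mono (yes a) (no ¬b) f = contradiction (f a) ¬b

card : {P : Fin n → Set} → Decidable P → ℕ
card P? = sum (λ x → indicator (does (P? x)))

card-mono : {P Q : Fin n → Set} (P? : Decidable P) (Q? : Decidable Q) →
  (∀ x → P x → Q x) → card P? ≤ card Q?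
card-mono P? Q? P⊆Q = sum-mono (λ x → indicator-mono (P? x) (Q? x) (P⊆Q x))

card-mono-< : {P Q : Fin n → Set} (P? : Decidable P) (Q? : Decidable Q) →
  (∀ x → P x → Q x) → ∀ x → ¬ P x → Q x → card P? < card Q?
card-mono-< P? Q? P⊆Q x ¬Px Qx =
  sum-mono-< (λ x → indicator-mono (P? x) (Q? x) (P⊆Q x)) x
    (subst (_< indicator (does (Q? x))) (cong indicator (≡-sym (dec-false (P? x) ¬Px)))
      (≤-reflexive (cong indicator (≡-sym (dec-true (Q? x) Qx)))))

card≤n : {P : Fin n → Set} (P? : Decidable P) → card P? ≤ n
card≤n {n} P? = ≤-trans (sum-upper {n} _ (λ x → indicator≤1 (does (P? x)))) (≤-reflexive (*-identityʳ n))

card≥1 : {P : Fin n → Set} (P? : Decidable P) → ∀ x → P x → 1 ≤ card P?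
card≥1 P? zero    Px = ≤-trans (≤-reflexive (cong indicator (≡-sym (dec-true (P? zero) Px)))) (m≤m+n _ _)
card≥1 P? (suc x) Px = ≤-trans (card≥1 (P? ∘ suc) x Px) (m≤n+m _ _)

card≥2 : {P : Fin n → Set} (P? : Decidable P) → ∀ x y → x ≢ y → P x → P y → 2 ≤ card P?
card≥2 {P = P} P? x y x≢y Px Py =
  ≤-trans (s≤s (card≥1 (_≟ x) x refl))
    (card-mono-< (_≟ x) P? (λ { _ refl → Px }) y (x≢y ∘ ≡-sym) Py)

card>0⇒∃ : {P : Fin n → Set} (P? : Decidable P) → 0 < card P? → ∃ P
card>0⇒∃ {suc n} P? pos with P? zero
... | yes P0 = zero , P0
... | no _ with x , Px ← card>0⇒∃ (P? ∘ suc) pos = suc x , Px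

sum-indicator-≡ : (b : Fin k) → sum (λ a → indicator (does (b ≟ a))) ≡ 1
sum-indicator-≡ {suc k} zero    = cong suc (n≤0⇒n≡0 (≤-trans (sum-upper {k} _ (λ _ → z≤n)) (≤-reflexive (*-zeroʳ k))))
sum-indicator-≡ {suc k} (suc b) = sum-indicator-≡ b

-- Double counting: each `x` satisfying `P` lies in the fibre of exactly one `a`, and the two sums
-- are interchanged.
card-fibres : {P : Fin n → Set} (P? : Decidable P) (c : Fin n → Fin k) →
  card P? ≡ sum (λ a → card (λ x → P? x ×-dec (c x ≟ a)))
card-fibres {n} {k} P? c =
  trans (sum-cong-≗ split) (∑-comm (λ x a → indicator (does (P? x ×-dec (c x ≟ a)))))
  where
  split : ∀ x → indicator (does (P? x)) ≡ sum (λ a → indicator (does (P? x ×-dec (c x ≟ a))))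
  split x with P? x
  ... | yes _ = ≡-sym (sum-indicator-≡ (c x))
  ... | no _  = ≡-sym (n≤0⇒n≡0 (≤-trans (sum-upper {k} _ (λ _ → z≤n)) (≤-reflexive (*-zeroʳ k))))

-- Adjacency, walks and connected components.

adj? : (G : Graph n) → ∀ u v → Dec (adj G u v ≡ true)
adj? G u v = adj G u v Boolₚ.≟ true

adj-sym : (G : Graph n) → ∀ {u v} → adj G u v ≡ true → adj G v u ≡ true
adj-sym G {u} {v} uv = trans (sym G v u) uv

adj-irrefl : (G : Graph n) → ∀ {u v} → adj G u v ≡ true → u ≢ v
adj-irrefl G {u} uv refl with () ← trans (≡-sym uv) (irrefl G u)

degree≡card : (G : Graph n) → ∀ v → degree G v ≡ card (adj? G v)
degree≡card {n} G v =
  trans (cong ListAction.sum (map-tabulate id (λ u → indicator (adj G v u))))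
  (trans (sum-tabulate (λ u → indicator (adj G v u)))
         (sum-cong-≗ (λ u → cong indicator (does-adj? u))))
  where
  sum-tabulate : ∀ {n} (f : Fin n → ℕ) → ListAction.sum (tabulate f) ≡ sum f
  sum-tabulate {zero}  f = refl
  sum-tabulate {suc n} f = cong (f zero +_) (sum-tabulate (f ∘ suc))
  does-adj? : ∀ u → adj G v u ≡ does (adj? G v u)
  does-adj? u with adj G v u
  ... | true  = refl
  ... | false = refl

module _ {G : Graph n} where

  walk-map : ∀ {P Q : Fin n → Set} → (∀ x → P x → Q x) → ∀ {u v} → Walk G P u v → Walk G Q u v
  walk-map P⊆Q (here Pu)       = here (P⊆Q _ Pu)
  walk-map P⊆Q (step Pu uw ww) = step (P⊆Q _ Pu) uw (walk-map P⊆Q ww)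

  walk-++ : ∀ {P u v w} → Walk G P u v → Walk G P v w → Walk G P u w
  walk-++ (here _)        q = q
  walk-++ (step Pu uw p) q = step Pu uw (walk-++ p q)

  walk-start : ∀ {P u v} → Walk G P u v → P u
  walk-start (here Pu)     = Pu
  walk-start (step Pu _ _) = Pu

  walk-reverse : ∀ {P u v} → Walk G P u v → Walk G P v u
  walk-reverse (here Pu)      = here Pu
  walk-reverse (step Pu uw p) =
    walk-++ (walk-reverse p) (step (walk-start p) (adj-sym G uw) (here Pu))

-- `walk` runs inside `member` rather than `P`, so `member` can serve as a branch set; `closed`
-- makes it a full component.
record Component (G : Graph n) (P : Fin n → Set) (r : Fin n) : Set₁ where
  field
    member  : Fin n → Set
    member? : Decidable member
    root    : member r
    inside  : ∀ w → member w → P w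
    walk    : ∀ w → member w → Walk G member r w
    closed  : ∀ w x → member w → adj G w x ≡ true → P x → member x

  walk-closed : ∀ {u w} → member u → Walk G P u w → member w
  walk-closed u∈ (here _)       = u∈
  walk-closed u∈ (step _ ux xw) = walk-closed (closed _ _ u∈ ux (walk-start xw)) xw

-- Grows a set from `r` by one adjacent vertex of `P` at a time. Each round raises the cardinality,
-- which `n` bounds, so by the invariant `n ≤ fuel + card M?` the fuel suffices.
component : (G : Graph n) {P : Fin n → Set} → Decidable P → ∀ {r} → P r → Component G P r
component {n} G {P} P? {r} Pr =
  grow n (_≡ r) (_≟ r) refl (λ { _ refl → Pr }) (λ { _ refl → here refl }) (m≤m+n n _)
  where
  grow : ∀ fuel (M : Fin n → Set) (M? : Decidable M) → M r → (∀ w → M w → P w) →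
    (∀ w → M w → Walk G M r w) → n ≤ fuel + card M? → Component G P r
  grow fuel M M? Mr M⊆P M-walk bound
    with any? (λ w → any? (λ x → M? w ×-dec adj? G w x ×-dec P? x ×-dec ¬? (M? x)))
  ... | no closed = record
    { member = M ; member? = M? ; root = Mr ; inside = M⊆P ; walk = M-walk
    ; closed = λ w x Mw wx Px → decidable-stable (M? x) (λ ¬Mx → closed (w , x , Mw , wx , Px , ¬Mx)) }
  ... | yes (w , x , Mw , wx , Px , ¬Mx) = extend fuel bound
    where
    M′ : Fin n → Set
    M′ y = M y ⊎ y ≡ x
    M′? : Decidable M′
    M′? y = M? y ⊎-dec (y ≟ x)
    larger : card M? < card M′?
    larger = card-mono-< M? M′? (λ _ → inj₁) x ¬Mx (inj₂ refl)
    M′-walk : ∀ y → M′ y → Walk G M′ r y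
    M′-walk y (inj₁ My)   = walk-map (λ _ → inj₁) (M-walk y My)
    M′-walk y (inj₂ refl) =
      walk-++ (walk-map (λ _ → inj₁) (M-walk w Mw)) (step (inj₁ Mw) wx (here (inj₂ refl)))
    extend : ∀ fuel → n ≤ fuel + card M? → Component G P r
    extend zero       bound = contradiction (≤-trans larger (card≤n M′?)) (≤⇒≯ bound)
    extend (suc fuel) bound =
      grow fuel M′ M′? (inj₁ Mr) (λ { y (inj₁ My) → M⊆P y My ; y (inj₂ refl) → Px }) M′-walk
        (≤-trans bound (≤-trans (≤-reflexive (≡-sym (+-suc fuel _))) (+-monoʳ-≤ fuel larger)))

-- Minor models and contractions.

-- Branch sets are easier to build as predicates than as a `Maybe`-valued map; symmetry of `adj`
-- leaves only the pairs `i < j` to check.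
minor-from-sets : (G : Graph n) (B : Fin s → Fin n → Set) → (∀ i → Decidable (B i)) →
  (∀ {i j} x → B i x → B j x → i ≡ j) →
  (∀ i → ∃ (B i)) →
  (∀ i u v → B i u → B i v → Walk G (B i) u v) →
  (∀ i j → i Fin.< j → ∃[ u ] ∃[ v ] (B i u × B j v × adj G u v ≡ true)) →
  KMinor G s
minor-from-sets {n} {s} G B B? disjoint nonempty connected adjacent = record
  { branch    = branch
  ; nonempty  = λ i → let x , Bx = nonempty i in x , from i x Bx
  ; connected = λ i u v bu bv → walk-map (from i) (connected i u v (to i u bu) (to i v bv))
  ; adjacent  = adjacent′
  }
  where
  branch : Fin n → Maybe (Fin s)
  branch x with any? (λ i → B? i x)
  ... | yes (i , _) = just i
  ... | no _        = nothing
  from : ∀ i x → B i x → branch x ≡ just i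
  from i x Bx with any? (λ i → B? i x)
  ... | yes (j , Bj) = cong just (disjoint x Bj Bx)
  ... | no ¬B        = contradiction (i , Bx) ¬B
  to : ∀ i x → branch x ≡ just i → B i x
  to i x bx with any? (λ i → B? i x) | bx
  ... | yes (j , Bj) | refl = Bj
  ... | no _         | ()
  adjacent′ : ∀ i j → i ≢ j → ∃[ u ] ∃[ v ] (branch u ≡ just i × branch v ≡ just j × adj G u v ≡ true)
  adjacent′ i j i≢j with <-cmp i j
  ... | tri≈ _ i≡j _ = contradiction i≡j i≢j
  ... | tri< i<j _ _ with u , v , Bu , Bv , uv ← adjacent i j i<j =
        u , v , from i u Bu , from j v Bv , uv
  ... | tri> _ _ j<i with u , v , Bu , Bv , uv ← adjacent j i j<i =
        v , u , from i v Bv , from j u Bu , adj-sym G uv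

lookup-injective : ∀ {A : Set} {xs : List A} → Unique xs → ∀ i j → lookup xs i ≡ lookup xs j → i ≡ j
lookup-injective (_ ∷ _)  zero    zero    _  = refl
lookup-injective (x∉ ∷ _) zero    (suc j) eq = contradiction eq (All.lookup x∉ (∈-lookup j))
lookup-injective (x∉ ∷ _) (suc i) zero    eq = contradiction (≡-sym eq) (All.lookup x∉ (∈-lookup i))
lookup-injective (_ ∷ u)  (suc i) (suc j) eq = cong suc (lookup-injective u i j eq)

-- The minor of G obtained by contracting each x onto rep x and deleting every
-- vertex whose representative does not satisfy Q.
module Contraction (G : Graph n) (rep : Fin n → Fin n) {Q : Fin n → Set} (Q? : Decidable Q)
  (rep-fix : ∀ x → Q x → rep x ≡ x)
  (rep-adj : ∀ x → Q (rep x) → x ≡ rep x ⊎ adj G x (rep x) ≡ true) where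

  kept : List (Fin n)
  kept = filter Q? (allFin n)

  size : ℕ
  size = length kept

  size<n : ∀ x → ¬ Q x → size < n
  size<n x ¬Qx = subst (size <_) (length-tabulate {n = n} id)
    (filter-notAll Q? (allFin n) (lose (∈-allFin x) ¬Qx))

  ι : Fin size → Fin n
  ι = lookup kept

  ι-injective : ∀ {y z} → ι y ≡ ι z → y ≡ z
  ι-injective = lookup-injective (filter⁺ Q? (allFin⁺ n)) _ _

  ι-Q : ∀ y → Q (ι y)
  ι-Q y = proj₂ (∈-filter⁻ Q? {xs = allFin n} (∈-lookup y))

  ι-surjective : ∀ x → Q x → ∃[ y ] x ≡ ι y
  ι-surjective x Qx = Any.index x∈ , lookup-index x∈
    where
    x∈ : x ∈ kept
    x∈ = ∈-filter⁺ Q? (∈-allFin x) Qx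

  -- The condition `y ≢ z` discards the loops that edges within a fibre would create.
  Joined : Fin size → Fin size → Set
  Joined y z = y ≢ z × ∃[ a ] ∃[ b ] (rep a ≡ ι y × rep b ≡ ι z × adj G a b ≡ true)

  joined? : ∀ y z → Dec (Joined y z)
  joined? y z = ¬? (y ≟ z) ×-dec
    any? (λ a → any? (λ b → (rep a ≟ ι y) ×-dec (rep b ≟ ι z) ×-dec adj? G a b))

  joined-sym : ∀ {y z} → Joined y z → Joined z y
  joined-sym (y≢z , a , b , ra , rb , ab) = y≢z ∘ ≡-sym , b , a , rb , ra , adj-sym G ab

  contracted : Graph size
  contracted = record
    { adj    = λ y z → does (joined? y z)
    ; sym    = λ y z → does-⇔ (mk⇔ joined-sym joined-sym) (joined? y z) (joined? z y)
    ; irrefl = λ y → dec-false (joined? y y) (λ j → proj₁ j refl)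
    }

  -- A fibre of `rep` contains a spanning star: by `rep-adj` each of its vertices is the centre
  -- `ι y` or adjacent to it.
  fibre-walk : ∀ y x → rep x ≡ ι y → Walk G (λ z → rep z ≡ ι y) x (ι y)
  fibre-walk y x rx with rep-adj x (subst Q (≡-sym rx) (ι-Q y))
  ... | inj₁ x≡ = subst (Walk G _ x) (trans x≡ rx) (here rx)
  ... | inj₂ xr = step rx (subst (λ z → adj G x z ≡ true) rx xr) (here (rep-fix (ι y) (ι-Q y)))

  -- Each branch set becomes the union of the fibres of its vertices. Fibres are connected, and
  -- every edge of `contracted` comes from an edge of `G`.
  minor-lift : KMinor contracted s → KMinor G s
  minor-lift {s} M = minor-from-sets G B
    (λ i x → any? (λ y → (rep x ≟ ι y) ×-dec ≡-dec _≟_ (branch y) (just i)))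
    (λ { x (y , ry , by) (z , rz , bz) →
         just-injective (trans (≡-sym by) (trans (cong branch (ι-injective (trans (≡-sym ry) rz))) bz)) })
    (λ i → let y , by = nonempty i in ι y , y , rep-fix (ι y) (ι-Q y) , by)
    (λ { i u v (y , ry , by) (z , rz , bz) → lift (connected i y z by bz) ry rz })
    (λ i j i<j → let y , z , by , bz , yz = adjacent i j (λ { refl → <-irrefl refl i<j })
                     _ , a , b , ra , rb , ab = does-true⇒ (joined? y z) yz
                 in a , b , (y , ra , by) , (z , rb , bz) , ab)
    where
    open KMinor M
    B : Fin s → Fin n → Set
    B i x = ∃[ y ] (rep x ≡ ι y × branch y ≡ just i)
    same-fibre : ∀ {i y u v} → branch y ≡ just i → rep u ≡ ι y → rep v ≡ ι y → Walk G (B i) u v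
    same-fibre {y = y} by ru rv = walk-map (λ x rx → y , rx , by)
      (walk-++ (fibre-walk y _ ru) (walk-reverse (fibre-walk y _ rv)))
    lift : ∀ {i y z u v} → Walk contracted (λ y → branch y ≡ just i) y z →
      rep u ≡ ι y → rep v ≡ ι z → Walk G (B i) u v
    lift (here by) ru rv = same-fibre by ru rv
    lift {y = y} (step {w = w} by yw ws) ru rv
      with _ , a , b , ra , rb , ab ← does-true⇒ (joined? y w) yw =
      walk-++ (same-fibre by ru ra) (step (y , ra , by) ab (lift ws rb rv))

  colouring-pullback : Colourable contracted (suc k) → Σ (Fin n → Fin (suc k)) λ c →
    (∀ x y → Q (rep x) → Q (rep y) → rep x ≢ rep y → adj G x y ≡ true → c x ≢ c y) ×
    (∀ x y → rep x ≡ rep y → c x ≡ c y)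
  colouring-pullback {k} (col , proper) = colour ∘ rep , proper′ , (λ x y → cong colour)
    where
    colour : Fin n → Fin (suc k)
    colour x with any? (λ y → x ≟ ι y)
    ... | yes (y , _) = col y
    -- A default outside `Q`, where properness is not claimed; it exists because the number of
    -- colours is a successor.
    ... | no _        = zero
    colour-ι : ∀ {x} y → x ≡ ι y → colour x ≡ col y
    colour-ι {x} y x≡ with any? (λ y → x ≟ ι y)
    ... | yes (z , x≡′) = cong col (ι-injective (trans (≡-sym x≡′) x≡))
    ... | no ¬y         = contradiction (y , x≡) ¬y
    proper′ : ∀ x y → Q (rep x) → Q (rep y) → rep x ≢ rep y → adj G x y ≡ true →
      colour (rep x) ≢ colour (rep y)
    proper′ x y Qx Qy rx≢ry xy same
      with p , rx ← ι-surjective (rep x) Qx | q , ry ← ι-surjective (rep y) Qy =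
      proper p q
        (dec-true (joined? p q)
          ((λ { refl → rx≢ry (trans rx (≡-sym ry)) }) , x , y , rx , ry , xy))
        (trans (≡-sym (colour-ι p rx)) (trans same (colour-ι q ry)))

-- Grundy colourings.

-- Starting from the injective colouring `toℕ`, a vertex of `X` is moved to a smaller colour absent
-- from its neighbours in `X` as long as possible. The sum of all colours drops each time, so this
-- stops.
grundy-colouring : (G : Graph n) {X : Fin n → Set} → Decidable X → Σ (Fin n → ℕ) λ f →
  (∀ x y → X x → X y → adj G x y ≡ true → f x ≢ f y) ×
  (∀ x → X x → ∀ i → i < f x → ∃[ w ] (X w × f w ≡ i × adj G x w ≡ true))
grundy-colouring {n} G {X} X? =
  lower (sum {n} toℕ) toℕ (λ x y _ _ xy → adj-irrefl G xy ∘ toℕ-injective) ≤-refl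
  where
  Proper : (Fin n → ℕ) → Set
  Proper f = ∀ x y → X x → X y → adj G x y ≡ true → f x ≢ f y
  Blocked : (Fin n → ℕ) → Fin n → ℕ → Set
  Blocked f x i = ∃[ w ] (X w × f w ≡ i × adj G x w ≡ true)
  blocked? : ∀ f x i → Dec (Blocked f x i)
  blocked? f x i = any? (λ w → X? w ×-dec (f w ℕₚ.≟ i) ×-dec adj? G x w)
  lower : ∀ fuel f → Proper f → sum f ≤ fuel →
    Σ (Fin n → ℕ) λ f → Proper f × (∀ x → X x → ∀ i → i < f x → Blocked f x i)
  lower fuel f proper bound
    with any? (λ x → X? x ×-dec anyUpTo? (λ i → ¬? (blocked? f x i)) (f x))
  ... | no stable = f , proper , λ x Xx i i<fx →
        decidable-stable (blocked? f x i) (λ ¬b → stable (x , Xx , i , i<fx , ¬b))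
  ... | yes (x , Xx , i , i<fx , free) = recurse fuel bound
    where
    f′ : Fin n → ℕ
    f′ y with y ≟ x
    ... | yes _ = i
    ... | no _  = f y
    f′≤f : ∀ y → f′ y ≤ f y
    f′≤f y with y ≟ x
    ... | yes refl = <⇒≤ i<fx
    ... | no _     = ≤-refl
    f′x<fx : f′ x < f x
    f′x<fx with x ≟ x
    ... | yes _  = i<fx
    ... | no x≢x = contradiction refl x≢x
    proper′ : Proper f′
    proper′ y z Xy Xz yz with y ≟ x | z ≟ x
    ... | yes refl | yes refl = contradiction refl (adj-irrefl G yz)
    ... | yes refl | no _     = λ i≡ → free (z , Xz , ≡-sym i≡ , yz)
    ... | no _     | yes refl = λ i≡ → free (y , Xy , i≡ , adj-sym G yz)
    ... | no _     | no _     = proper y z Xy Xz yz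
    smaller : sum f′ < sum f
    smaller = sum-mono-< f′≤f x f′x<fx
    recurse : ∀ fuel → sum f ≤ fuel → Σ (Fin n → ℕ) λ f → Proper f × (∀ x → X x → ∀ i → i < f x → Blocked f x i)
    recurse zero       bound = contradiction (≤-trans smaller bound) λ ()
    recurse (suc fuel) bound = lower fuel f′ proper′ (≤-pred (≤-trans smaller bound))

-- Kempe chains around a vertex.

-- Lets the search over pairs of vertices end early with a finished colouring, in the role of `A`.
⊎-collect : ∀ {A : Set} {B : Fin n → Set} → (∀ i → A ⊎ B i) → A ⊎ (∀ i → B i)
⊎-collect {zero}  f = inj₂ λ ()
⊎-collect {suc n} f with f zero | ⊎-collect (f ∘ suc)
... | inj₁ a | _       = inj₁ a
... | inj₂ _ | inj₁ a  = inj₁ a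
... | inj₂ b | inj₂ bs = inj₂ λ { zero → b ; (suc i) → bs i }

-- A total map with arbitrary value at `v` stands for a colouring of `G - v`, so that no subgraph
-- has to be built.
ProperOff : (G : Graph n) (v : Fin n) → (Fin n → Fin k) → Set
ProperOff G v c = ∀ x y → x ≢ v → y ≢ v → adj G x y ≡ true → c x ≢ c y

extend-colouring : (G : Graph n) (v : Fin n) (c : Fin n → Fin k) → ProperOff G v c →
  ∀ a → (∀ w → adj G v w ≡ true → c w ≢ a) → Colourable G k
extend-colouring {n} {k} G v c proper a free = c′ , proper′
  where
  c′ : Fin n → Fin k
  c′ w with w ≟ v
  ... | yes _ = a
  ... | no _  = c w
  proper′ : ∀ x y → adj G x y ≡ true → c′ x ≢ c′ y
  proper′ x y xy with x ≟ v | y ≟ v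
  ... | yes refl | yes refl = contradiction refl (adj-irrefl G xy)
  ... | yes refl | no _     = λ a≡ → free y xy (≡-sym a≡)
  ... | no _     | yes refl = free x (adj-sym G xy)
  ... | no x≢v   | no y≢v   = proper x y x≢v y≢v xy

module Kempe (G : Graph n) (v : Fin n) (c : Fin n → Fin k) (proper : ProperOff G v c) where

  Solitary : Fin n → Set
  Solitary x = adj G v x ≡ true × (∀ w → adj G v w ≡ true → c w ≡ c x → w ≡ x)

  solitary? : Decidable Solitary
  solitary? x = adj? G v x ×-dec all? (λ w → adj? G v w →-dec (c w ≟ c x) →-dec (w ≟ x))

  nbr≢v : ∀ {x} → adj G v x ≡ true → x ≢ v
  nbr≢v vx = adj-irrefl G vx ∘ ≡-sym

  Bicoloured : Fin n → Fin n → Fin n → Set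
  Bicoloured x y w = w ≢ v × (c w ≡ c x ⊎ c w ≡ c y)

  -- Swap the two colours on the component of `x`. If `y` lies outside it, the swap takes `c x` away
  -- from `x`, the only neighbour of `v` that had it, and gives it to no other neighbour, since only
  -- `y` has colour `c y`. So `c x` is free for `v`.
  kempe-chain : ∀ x y → Solitary x → Solitary y → Colourable G k ⊎ Walk G (Bicoloured x y) x y
  kempe-chain x y (vx , x-only) (vy , y-only) = result
    where
    C : Component G (Bicoloured x y) x
    C = component G (λ w → ¬? (w ≟ v) ×-dec ((c w ≟ c x) ⊎-dec (c w ≟ c y))) (nbr≢v vx , inj₁ refl)
    open Component C

    swapped : Fin n → Fin k
    swapped w with member? w | c w ≟ c x
    ... | yes _ | yes _ = c y
    ... | yes _ | no _  = c x
    ... | no _  | _     = c w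

    swapped-in : ∀ w → member w → (c w ≡ c x × swapped w ≡ c y) ⊎ (c w ≡ c y × swapped w ≡ c x)
    swapped-in w w∈ with member? w | c w ≟ c x
    ... | yes _ | yes cx = inj₁ (cx , refl)
    ... | yes _ | no c≢  with proj₂ (inside w w∈)
    ...   | inj₁ cx = contradiction cx c≢
    ...   | inj₂ cy = inj₂ (cy , refl)
    swapped-in w w∈ | no w∉ | _ = contradiction w∈ w∉

    swapped-out : ∀ w → ¬ member w → swapped w ≡ c w
    swapped-out w w∉ with member? w | c w ≟ c x
    ... | yes w∈ | _ = contradiction w∈ w∉
    ... | no _   | _ = refl

    swapped-bicoloured : ∀ w → member w → swapped w ≡ c x ⊎ swapped w ≡ c y
    swapped-bicoloured w w∈ with swapped-in w w∈
    ... | inj₁ (_ , s) = inj₂ s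
    ... | inj₂ (_ , s) = inj₁ s

    -- A clash would give `z` one of the two swapped colours, and a bicoloured neighbour of the
    -- component belongs to it.
    boundary : ∀ w z → member w → ¬ member z → z ≢ v → adj G w z ≡ true → swapped w ≢ swapped z
    boundary w z w∈ z∉ z≢v wz same = z∉ (closed w z w∈ wz (z≢v , bicoloured))
      where
      same′ : swapped w ≡ c z
      same′ = trans same (swapped-out z z∉)
      bicoloured : c z ≡ c x ⊎ c z ≡ c y
      bicoloured with swapped-bicoloured w w∈
      ... | inj₁ s = inj₁ (trans (≡-sym same′) s)
      ... | inj₂ s = inj₂ (trans (≡-sym same′) s)

    swapped-proper : ProperOff G v swapped
    swapped-proper w z w≢v z≢v wz same = cases (member? w) (member? z)
      where
      cases : Dec (member w) → Dec (member z) → ⊥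
      cases (no w∉)  (no z∉)  = proper w z w≢v z≢v wz
        (trans (≡-sym (swapped-out w w∉)) (trans same (swapped-out z z∉)))
      cases (yes w∈) (no z∉)  = boundary w z w∈ z∉ z≢v wz same
      cases (no w∉)  (yes z∈) = boundary z w z∈ w∉ w≢v (adj-sym G wz) (≡-sym same)
      cases (yes w∈) (yes z∈) with swapped-in w w∈ | swapped-in z z∈
      ... | inj₁ (cw , _)  | inj₁ (cz , _)  = proper w z w≢v z≢v wz (trans cw (≡-sym cz))
      ... | inj₂ (cw , _)  | inj₂ (cz , _)  = proper w z w≢v z≢v wz (trans cw (≡-sym cz))
      ... | inj₁ (cw , sw) | inj₂ (cz , sz) = proper w z w≢v z≢v wz
            (trans cw (trans (≡-sym sz) (trans (≡-sym same) (trans sw (≡-sym cz)))))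
      ... | inj₂ (cw , sw) | inj₁ (cz , sz) = proper w z w≢v z≢v wz
            (trans cw (trans (≡-sym sz) (trans (≡-sym same) (trans sw (≡-sym cz)))))

    result : Colourable G k ⊎ Walk G (Bicoloured x y) x y
    result with member? y
    ... | yes y∈ = inj₂ (walk-map inside (walk y y∈))
    ... | no y∉  = inj₁ (extend-colouring G v swapped swapped-proper (c x) free)
      where
      free : ∀ w → adj G v w ≡ true → swapped w ≢ c x
      free w vw eq = cases (member? w)
        where
        cases : Dec (member w) → ⊥
        cases (no w∉) = w∉ (subst member (≡-sym (x-only w vw (trans (≡-sym (swapped-out w w∉)) eq))) root)
        cases (yes w∈) with swapped-in w w∈
        ... | inj₁ (_ , sw) = y∉ (subst member (≡-sym (x-only y vy (trans (≡-sym sw) eq))) root)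
        ... | inj₂ (cw , _) = y∉ (subst member (y-only w vw cw) w∈)

  kempe-chains : Colourable G k ⊎ (∀ x y → Solitary x → Solitary y → Walk G (Bicoloured x y) x y)
  kempe-chains = ⊎-collect λ x → ⊎-collect λ y → pair x y
    where
    pair : ∀ x y → Colourable G k ⊎ (Solitary x → Solitary y → Walk G (Bicoloured x y) x y)
    pair x y with solitary? x | solitary? y
    ... | no ¬x | _     = inj₂ λ x∈ → contradiction x∈ ¬x
    ... | yes _ | no ¬y = inj₂ λ _ y∈ → contradiction y∈ ¬y
    ... | yes sx | yes sy with kempe-chain x y sx sy
    ...   | inj₁ col = inj₁ col
    ...   | inj₂ w   = inj₂ λ _ _ → w

  -- Chains for disjoint sets of colours are disjoint, so the first t classes of f
  -- can be made connected simultaneously; v and u are two further branch sets.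
  module RootedMinor (chain : ∀ x y → Solitary x → Solitary y → Walk G (Bicoloured x y) x y)
    (t : ℕ) (f : Fin n → ℕ)
    (grundy : ∀ x → Solitary x → ∀ i → i < f x → ∃[ w ] (Solitary w × f w ≡ i × adj G x w ≡ true))
    (u : Fin n) (vu : adj G v u ≡ true) (u∉ : ¬ (Solitary u × f u < t))
    (sees : ∀ (i : Fin t) → ∃[ x ] (Solitary x × f x ≡ toℕ i × adj G u x ≡ true)) where

    Class : Fin t → Fin n → Set
    Class i x = Solitary x × f x ≡ toℕ i

    -- A neighbour of `u` and, being solitary, of `v`, so the component grown from it is joined to
    -- both.
    rep : Fin t → Fin n
    rep i = proj₁ (sees i)

    rep-class : ∀ i → Class i (rep i)
    rep-class i = let _ , s , fx , _ = sees i in s , fx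

    Palette : Fin t → Fin n → Set
    Palette i w = w ≢ v × ∃[ x ] (Class i x × c w ≡ c x)

    palette? : ∀ i → Decidable (Palette i)
    palette? i w = ¬? (w ≟ v) ×-dec
      any? (λ x → (solitary? x ×-dec (f x ℕₚ.≟ toℕ i)) ×-dec (c w ≟ c x))

    class-palette : ∀ i x → Class i x → Palette i x
    class-palette i x x∈ = nbr≢v (proj₁ (proj₁ x∈)) , x , x∈ , refl

    -- Solitary vertices of equal colour coincide, so distinct classes use disjoint sets of colours.
    palette-disjoint : ∀ {i j} w → Palette i w → Palette j w → i ≡ j
    palette-disjoint w (_ , x , (sx , fx) , cx) (_ , y , (sy , fy) , cy) =
      toℕ-injective (trans (≡-sym fx) (trans (cong f x≡y) fy))
      where
      x≡y : x ≡ y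
      x≡y = proj₂ sy x (proj₁ sx) (trans (≡-sym cx) cy)

    -- As `u` is a neighbour of `v`, sharing a colour with a solitary vertex would make it that
    -- vertex, against `u∉`.
    u∉palette : ∀ i → ¬ Palette i u
    u∉palette i (_ , x , (sx , fx) , cx) =
      u∉ (subst Solitary x≡u sx , subst (_< t) (trans (≡-sym fx) (cong f x≡u)) (toℕ<n i))
      where
      x≡u : x ≡ u
      x≡u = ≡-sym (proj₂ sx u vu cx)

    comp : ∀ i → Component G (Palette i) (rep i)
    comp i = component G (palette? i) (class-palette i (rep i) (rep-class i))

    module Comp i = Component (comp i)

    -- The Kempe chain from the representative uses only two colours, both belonging to class `i`,
    -- so it stays in the palette.
    class⊆comp : ∀ i x → Class i x → Comp.member i x
    class⊆comp i x x∈ = Comp.walk-closed i (Comp.root i)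
      (walk-map bicoloured⊆palette (chain (rep i) x (proj₁ (rep-class i)) (proj₁ x∈)))
      where
      bicoloured⊆palette : ∀ w → Bicoloured (rep i) x w → Palette i w
      bicoloured⊆palette w (w≢v , inj₁ cw) = w≢v , rep i , rep-class i , cw
      bicoloured⊆palette w (w≢v , inj₂ cw) = w≢v , x , x∈ , cw

    B : Fin (suc (suc t)) → Fin n → Set
    B zero          = _≡ v
    B (suc zero)    = _≡ u
    B (suc (suc i)) = Comp.member i

    B? : ∀ i → Decidable (B i)
    B? zero          = _≟ v
    B? (suc zero)    = _≟ u
    B? (suc (suc i)) = Comp.member? i

    disjoint : ∀ i j x → B i x → B j x → i ≡ j
    disjoint zero          zero          x _    _    = refl
    disjoint zero          (suc zero)    x refl refl = contradiction refl (nbr≢v vu)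
    disjoint zero          (suc (suc j)) x refl x∈   = contradiction refl (proj₁ (Comp.inside j x x∈))
    disjoint (suc zero)    zero          x refl refl = contradiction refl (nbr≢v vu)
    disjoint (suc zero)    (suc zero)    x _    _    = refl
    disjoint (suc zero)    (suc (suc j)) x refl x∈   = contradiction (Comp.inside j x x∈) (u∉palette j)
    disjoint (suc (suc i)) zero          x x∈   refl = contradiction refl (proj₁ (Comp.inside i x x∈))
    disjoint (suc (suc i)) (suc zero)    x x∈   refl = contradiction (Comp.inside i x x∈) (u∉palette i)
    disjoint (suc (suc i)) (suc (suc j)) x x∈   x∈′  =
      cong (λ i → suc (suc i)) (palette-disjoint x (Comp.inside i x x∈) (Comp.inside j x x∈′))

    nonempty : ∀ i → ∃ (B i)
    nonempty zero          = v , refl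
    nonempty (suc zero)    = u , refl
    nonempty (suc (suc i)) = rep i , Comp.root i

    connected : ∀ i x y → B i x → B i y → Walk G (B i) x y
    connected zero          x y refl refl = here refl
    connected (suc zero)    x y refl refl = here refl
    connected (suc (suc i)) x y x∈   y∈   = walk-++ (walk-reverse (Comp.walk i x x∈)) (Comp.walk i y y∈)

    adjacent : ∀ i j → i Fin.< j → ∃[ x ] ∃[ y ] (B i x × B j y × adj G x y ≡ true)
    adjacent zero (suc zero)    _ = v , u , refl , refl , vu
    adjacent zero (suc (suc j)) _ = v , rep j , refl , Comp.root j , proj₁ (proj₁ (rep-class j))
    adjacent (suc zero) (suc zero) (s≤s ())
    adjacent (suc zero) (suc (suc j)) _ = u , rep j , refl , Comp.root j , proj₂ (proj₂ (proj₂ (sees j)))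
    adjacent (suc (suc i)) (suc zero) (s≤s ())
    adjacent (suc (suc i)) (suc (suc j)) (s≤s (s≤s i<j)) =
      -- The Grundy property gives `rep j` a neighbour in the lower class `i`, and that whole class
      -- lies in component `i`.
      let sj , fj = rep-class j
          w , sw , fw , jw = grundy (rep j) sj (toℕ i) (subst (toℕ i <_) (≡-sym fj) i<j)
      in w , rep j , class⊆comp i w (sw , fw) , Comp.root j , adj-sym G jw

    minor : KMinor G (suc (suc t))
    minor = minor-from-sets G B B? (λ {i} {j} → disjoint i j) nonempty connected adjacent

-- Colourings obtained from smaller minors.

IndependentIn : (G : Graph n) (v : Fin n) → (Fin n → Set) → Set
IndependentIn G v S = (∀ x → S x → adj G v x ≡ true) × (∀ x y → S x → S y → adj G x y ≢ true)

ColourableBelow : ℕ → ℕ → ℕ → Set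
ColourableBelow n s k = ∀ {m} → m < n → (H : Graph m) → KMinorFree H s → Colourable H k

-- Contracting the nonempty `S` onto `v` lowers the order, so `ih` applies. As `S` is independent,
-- no edge avoiding `v` has both ends in one fibre.
contract-star : (G : Graph n) → KMinorFree G s → ColourableBelow n s (suc k) → ∀ v {S : Fin n → Set} →
  Decidable S → IndependentIn G v S → ∃ S →
  Σ (Fin n → Fin (suc k)) λ c → ProperOff G v c × (∀ x y → S x → S y → c x ≡ c y)
contract-star {n} G free ih v {S} S? (S⊆N , indep) (s₀ , Ss₀) =
  let c , proper , same = colouring-pullback (ih (size<n s₀ (λ ¬S → ¬S Ss₀)) contracted (free ∘ minor-lift))
  in c , (λ x y x≢v y≢v xy → proper x y (rep∉S x) (rep∉S y) (rep-distinct x y x≢v y≢v xy) xy)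
       , (λ x y Sx Sy → same x y (trans (rep-S x Sx) (≡-sym (rep-S y Sy))))
  where
  rep : Fin n → Fin n
  rep x with S? x
  ... | yes _ = v
  ... | no _  = x
  v∉S : ¬ S v
  v∉S Sv = adj-irrefl G (S⊆N v Sv) refl
  rep∉S : ∀ x → ¬ S (rep x)
  rep∉S x with S? x
  ... | yes _  = v∉S
  ... | no x∉S = x∉S
  rep-S : ∀ x → S x → rep x ≡ v
  rep-S x Sx with S? x
  ... | yes _  = refl
  ... | no x∉S = contradiction Sx x∉S
  rep-fix : ∀ x → ¬ S x → rep x ≡ x
  rep-fix x x∉S with S? x
  ... | yes Sx = contradiction Sx x∉S
  ... | no _   = refl
  rep-adj : ∀ x → ¬ S (rep x) → x ≡ rep x ⊎ adj G x (rep x) ≡ true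
  rep-adj x _ with S? x
  ... | yes Sx = inj₂ (adj-sym G (S⊆N x Sx))
  ... | no _   = inj₁ refl
  rep-distinct : ∀ x y → x ≢ v → y ≢ v → adj G x y ≡ true → rep x ≢ rep y
  rep-distinct x y x≢v y≢v xy with S? x | S? y
  ... | yes Sx | yes Sy = contradiction xy (indep x y Sx Sy)
  ... | yes _  | no _   = y≢v ∘ ≡-sym
  ... | no _   | yes _  = x≢v
  ... | no _   | no _   = adj-irrefl G xy
  open Contraction G rep (¬? ∘ S?) rep-fix rep-adj

delete-vertex : (G : Graph n) → KMinorFree G s → ColourableBelow n s (suc k) → ∀ v →
  Σ (Fin n → Fin (suc k)) (ProperOff G v)
delete-vertex G free ih v =
  let c , proper , _ = colouring-pullback (ih (size<n v (λ v≢v → v≢v refl)) contracted (free ∘ minor-lift))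
  in c , λ x y x≢v y≢v xy → proper x y x≢v y≢v (adj-irrefl G xy) xy
  -- With singleton fibres the contraction is the deletion of `v`.
  where open Contraction G id (λ x → ¬? (x ≟ v)) (λ _ _ → refl) (λ _ _ → inj₁ refl)

-- Counting colours around a vertex.

module Counting (G : Graph n) (v : Fin n) (c : Fin n → Fin (suc k)) (proper : ProperOff G v c)
  {S : Fin n → Set} (S? : Decidable S) (S⊆N : ∀ x → S x → adj G v x ≡ true)
  (mono : ∀ x y → S x → S y → c x ≡ c y) (s₀ : Fin n) (Ss₀ : S s₀)
  (all-used : ∀ a → ∃[ w ] (adj G v w ≡ true × c w ≡ a)) where

  open Kempe G v c proper

  core? : Decidable (λ x → Solitary x ⊎ S x)
  core? x = solitary? x ⊎-dec S? x

  nbrs core : Fin (suc k) → ℕ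
  nbrs a = card (λ x → adj? G v x ×-dec (c x ≟ a))
  core a = card (λ x → core? x ×-dec (c x ≟ a))

  S≤nbrs : card S? ≤ nbrs (c s₀)
  S≤nbrs = card-mono S? (λ x → adj? G v x ×-dec (c x ≟ c s₀)) (λ x Sx → S⊆N x Sx , mono x s₀ Sx Ss₀)

  S≤core : card S? ≤ core (c s₀)
  S≤core = card-mono S? (λ x → core? x ×-dec (c x ≟ c s₀)) (λ x Sx → inj₂ Sx , mono x s₀ Sx Ss₀)

  1≤nbrs : ∀ a → 1 ≤ nbrs a
  1≤nbrs a with w , vw , cw ← all-used a = card≥1 (λ x → adj? G v x ×-dec (c x ≟ a)) w (vw , cw)

  -- If a colour occurs once around `v`, its vertex is solitary and counts in both terms; otherwise
  -- two neighbours count in `nbrs a`.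
  2≤core+nbrs : ∀ a → 2 ≤ core a + nbrs a
  2≤core+nbrs a with w , vw , refl ← all-used a with solitary? w
  ... | yes sol = +-mono-≤ (card≥1 (λ x → core? x ×-dec (c x ≟ c w)) w (inj₁ sol , refl)) (1≤nbrs (c w))
  ... | no ¬sol with any? (λ x → adj? G v x ×-dec (c x ≟ c w) ×-dec ¬? (x ≟ w))
  ...   | yes (x , vx , cx , x≢w) =
          ≤-trans (card≥2 (λ x → adj? G v x ×-dec (c x ≟ c w)) x w x≢w (vx , cx) (vw , refl)) (m≤n+m _ _)
  ...   | no none = contradiction
          (vw , λ x vx cx → decidable-stable (x ≟ w) (λ x≢w → none (x , vx , cx , x≢w))) ¬sol

  -- The colour of `S` occurs at least `card S?` times around `v`, each of the other `k` colours at
  -- least once.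
  S+k≤degree : k + card S? ≤ card (adj? G v)
  S+k≤degree = begin
    k + card S?      ≡⟨ cong (_+ card S?) (*-identityʳ k) ⟨
    k * 1 + card S?  ≤⟨ sum-lower-except nbrs (c s₀) (λ a _ → 1≤nbrs a) S≤nbrs ⟩
    sum nbrs         ≡⟨ card-fibres (adj? G v) c ⟨
    card (adj? G v)  ∎
    where open ≤-Reasoning

  -- Sums `2≤core+nbrs` over the colours, except that the colour of `S` contributes `card S?` to
  -- each of the two counts.
  core-lower : k * 2 + (card S? + card S?) ≤ card core? + card (adj? G v)
  core-lower = begin
    k * 2 + (card S? + card S?)    ≤⟨ sum-lower-except (λ a → core a + nbrs a) (c s₀) (λ a _ → 2≤core+nbrs a) (+-mono-≤ S≤core S≤nbrs) ⟩
    sum (λ a → core a + nbrs a)    ≡⟨ ∑-distrib-+ core nbrs ⟩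
    sum core + sum nbrs            ≡⟨ cong₂ _+_ (card-fibres core? c) (card-fibres (adj? G v) c) ⟨
    card core? + card (adj? G v)   ∎
    where open ≤-Reasoning

-- Adding the last two inequalities and cancelling leaves `t * j < t * α`, against `α ≤ j`.
counting-contradiction : ∀ t j k α → α ≤ j → j * suc (suc t) < k + j →
  ¬ (k * 2 + (α + α) ≤ suc (suc t) * α + (k + j))
counting-contradiction t j k α α≤j j<δ lower = <⇒≱ (s≤s (*-monoʳ-≤ t α≤j)) (+-cancelˡ-≤ (k * 2 + (α + α) + j * 2) _ _ (begin
  k * 2 + (α + α) + j * 2 + suc (t * j)             ≡⟨ ℕ-Ring.solve (t List.∷ j List.∷ k List.∷ α List.∷ List.[]) ⟩
  k * 2 + (α + α) + suc (j * suc (suc t))           ≤⟨ +-mono-≤ lower j<δ ⟩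
  suc (suc t) * α + (k + j) + (k + j)               ≡⟨ ℕ-Ring.solve (t List.∷ j List.∷ k List.∷ α List.∷ List.[]) ⟩
  k * 2 + (α + α) + j * 2 + t * α                   ∎))
  where open ≤-Reasoning

-- The inductive step.

-- Here suc (suc t) is the paper's t - 1, and k + j is its δ.
module ColouringStep (t j k : ℕ) (j-bound : 1 ≤ j → j * suc (suc t) < k + j)
  (G : Graph n) (free : KMinorFree G (suc (suc (suc (suc t)))))
  (ih : ColourableBelow n (suc (suc (suc (suc t)))) (suc k))
  (v : Fin n) (deg : card (adj? G v) ≤ k + j) where

  -- The fuel bounds `n ∸ card S?` from above, and each recursive call replaces `S` by a strictly
  -- larger independent set.
  from-independent : ∀ fuel {S : Fin n → Set} (S? : Decidable S) → IndependentIn G v S → ∃ S →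
    n ≤ fuel + card S? → Colourable G (suc k)
  from-independent fuel {S} S? S-indep@(S⊆N , indep) (s₀ , Ss₀) bound
    with c , proper , mono ← contract-star G free ih v S? S-indep (s₀ , Ss₀)
    with any? (λ a → all? (λ w → adj? G v w →-dec ¬? (c w ≟ a)))
  ... | yes (a , unused) = extend-colouring G v c proper a unused
  ... | no all-used with Kempe.kempe-chains G v c proper
  ...   | inj₁ col   = col
  ...   | inj₂ chain = result
    where
    open Kempe G v c proper
    used : ∀ a → ∃[ w ] (adj G v w ≡ true × c w ≡ a)
    used a = decidable-stable (any? (λ w → adj? G v w ×-dec (c w ≟ a)))
      (λ none → all-used (a , λ w vw cw → none (w , vw , cw)))
    open Counting G v c proper S? S⊆N mono s₀ Ss₀ used

    grundy = grundy-colouring G solitary?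
    f : Fin n → ℕ
    f = proj₁ grundy
    f-proper = proj₁ (proj₂ grundy)
    f-grundy = proj₂ (proj₂ grundy)

    Sees : Fin n → Fin (suc (suc t)) → Set
    Sees u i = ∃[ x ] (Solitary x × f x ≡ toℕ i × adj G u x ≡ true)
    sees? : ∀ u i → Dec (Sees u i)
    sees? u i = any? (λ x → solitary? x ×-dec (f x ℕₚ.≟ toℕ i) ×-dec adj? G u x)

    -- Covers two kinds of `u`: a solitary vertex of colour at least `suc (suc t)`, which sees all
    -- lower classes by the Grundy property, and a vertex of `S` that is not solitary.
    no-apex : ∀ u → adj G v u ≡ true → ¬ (Solitary u × f u < suc (suc t)) → ¬ (∀ i → Sees u i)
    no-apex u vu u∉ sees = free (RootedMinor.minor chain (suc (suc t)) f f-grundy u vu u∉ sees)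

    -- Chosen to make the classes of `h` independent: the Grundy colouring separates solitary
    -- vertices from each other, the second clause separates them from the rest of `S`, and `S`
    -- itself is independent.
    Fits : Fin n → Fin (suc (suc t)) → Set
    Fits x i = (Solitary x → f x ≡ toℕ i) × (S x → ¬ Solitary x → ¬ Sees x i)

    fit : ∀ x → ∃ (Fits x)
    fit x with solitary? x | S? x
    -- A default: `Class` ignores vertices that are neither solitary nor in `S`.
    ... | no ¬sx | no x∉S = zero , (λ sx → contradiction sx ¬sx) , λ Sx → contradiction Sx x∉S
    ... | no ¬sx | yes Sx
        with i , ¬sees ← ¬∀⟶∃¬ _ (Sees x) (sees? x) (no-apex x (S⊆N x Sx) (¬sx ∘ proj₁)) =
        i , (λ sx → contradiction sx ¬sx) , λ _ _ → ¬sees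
    ... | yes sx | _ with f x <? suc (suc t)
    ...   | yes fx< = fromℕ< fx< , (λ _ → ≡-sym (toℕ-fromℕ< fx<)) , λ _ ¬sx → contradiction sx ¬sx
    ...   | no fx≮  = contradiction
            (λ i → f-grundy x sx (toℕ i) (<-≤-trans (toℕ<n i) (≮⇒≥ fx≮)))
            (no-apex x (proj₁ sx) (fx≮ ∘ proj₂))

    h : Fin n → Fin (suc (suc t))
    h = proj₁ ∘ fit

    Class : Fin (suc (suc t)) → Fin n → Set
    Class i x = (Solitary x ⊎ S x) × h x ≡ i

    class? : ∀ i → Decidable (Class i)
    class? i x = core? x ×-dec (h x ≟ i)

    solitary-or-not : ∀ {x} → Solitary x ⊎ S x → Solitary x ⊎ (S x × ¬ Solitary x)
    solitary-or-not {x} x∈ with solitary? x | x∈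
    ... | yes sx | _       = inj₁ sx
    ... | no ¬sx | inj₁ sx = contradiction sx ¬sx
    ... | no ¬sx | inj₂ Sx = inj₂ (Sx , ¬sx)

    f≡h : ∀ {x} → Solitary x → f x ≡ toℕ (h x)
    f≡h {x} = proj₁ (proj₂ (fit x))

    mixed : ∀ {x y} → S x → ¬ Solitary x → Solitary y → h x ≡ h y → adj G x y ≢ true
    mixed {x} {y} Sx ¬sx sy hx≡hy xy =
      proj₂ (proj₂ (fit x)) Sx ¬sx (y , sy , trans (f≡h sy) (cong toℕ (≡-sym hx≡hy)) , xy)

    class-indep : ∀ i → IndependentIn G v (Class i)
    class-indep i = (λ x x∈ → [ proj₁ , S⊆N x ]′ (proj₁ x∈)) , pairs
      where
      pairs : ∀ x y → Class i x → Class i y → adj G x y ≢ true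
      pairs x y (x∈ , hx) (y∈ , hy) xy with solitary-or-not x∈ | solitary-or-not y∈
      ... | inj₁ sx         | inj₁ sy         =
            f-proper x y sx sy xy (trans (f≡h sx) (trans (cong toℕ (trans hx (≡-sym hy))) (≡-sym (f≡h sy))))
      ... | inj₁ sx         | inj₂ (Sy , ¬sy) = mixed Sy ¬sy sx (trans hy (≡-sym hx)) (adj-sym G xy)
      ... | inj₂ (Sx , ¬sx) | inj₁ sy         = mixed Sx ¬sx sy (trans hx (≡-sym hy)) xy
      ... | inj₂ (Sx , _)   | inj₂ (Sy , _)   = indep x y Sx Sy xy

    S≤j : card S? ≤ j
    S≤j = +-cancelˡ-≤ k _ _ (≤-trans S+k≤degree deg)

    enlarge : ∀ fuel i → card S? < card (class? i) → n ≤ fuel + card S? → Colourable G (suc k)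
    enlarge zero       i larger bound = contradiction (≤-trans larger (card≤n (class? i))) (≤⇒≯ bound)
    enlarge (suc fuel) i larger bound =
      from-independent fuel (class? i) (class-indep i) (card>0⇒∃ (class? i) (≤-trans z<s larger))
        (≤-trans bound (≤-trans (≤-reflexive (≡-sym (+-suc fuel _))) (+-monoʳ-≤ fuel larger)))

    result : Colourable G (suc k)
    result with any? (λ i → card S? <? card (class? i))
    ... | yes (i , larger) = enlarge fuel i larger bound
    -- Now each of the `suc (suc t)` classes is at most as large as `S`, which bounds the core from
    -- above.
    ... | no small = contradiction
          (≤-trans core-lower (+-mono-≤
            (≤-trans (≤-reflexive (card-fibres core? h))
              (sum-upper _ (λ i → ≮⇒≥ (λ larger → small (i , larger)))))
            deg))
          -- The nonempty `S` has at most `j` elements, so `1 ≤ j`; this excludes `δ = 0`, where the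
          -- strict inequality of `j-bound` fails.
          (counting-contradiction t j k (card S?) S≤j (j-bound (≤-trans (card≥1 S? s₀ Ss₀) S≤j)))

  colouring : Colourable G (suc k)
  colouring with any? (adj? G v)
  ... | no isolated = let c , proper = delete-vertex G free ih v in
        extend-colouring G v c proper zero (λ w vw → contradiction (w , vw) isolated)
  ... | yes (s , vs) = from-independent n (_≟ s)
        ((λ { _ refl → vs }) , λ { _ _ refl refl ss → adj-irrefl G ss refl }) (s , refl) (m≤m+n n _)

-- Induction on the order.

colourable : ∀ t j k → (1 ≤ j → j * suc (suc t) < k + j) →
  (∀ n (H : Graph (suc n)) → KMinorFree H (suc (suc (suc (suc t)))) → ∃[ v ] degree H v ≤ k + j) →
  ∀ n (G : Graph n) → KMinorFree G (suc (suc (suc (suc t)))) → Colourable G (suc k)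
colourable t j k j-bound low-degree =
  <-rec (λ n → (G : Graph n) → KMinorFree G (suc (suc (suc (suc t)))) → Colourable G (suc k)) induct
  where
  induct : ∀ n → (∀ {m} → m < n → (G : Graph m) → KMinorFree G (suc (suc (suc (suc t)))) → Colourable G (suc k)) →
    (G : Graph n) → KMinorFree G (suc (suc (suc (suc t)))) → Colourable G (suc k)
  induct zero    ih G free = (λ ()) , λ ()
  induct (suc n) ih G free with v , deg ← low-degree n G free =
    ColouringStep.colouring t j k j-bound G free ih v (subst (_≤ k + j) (degree≡card G v) deg)

-- The numerical bounds and the theorem.

-- `6 + a` is the `t` of the theorem, `k + j` is `δ`, `suc k` is the number of colours, and `s` is
-- the amount by which `δ` falls short of `(j + 1)(t - 1)`.
module _ (a j s k : ℕ) (slack : k + j + s ≡ suc j * (5 + a)) where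
  open ℤ using (+_)

  slack-ℤ : (+ 1 ℤ.+ + j) ℤ.* (+ 5 ℤ.+ + a) ℤ.- (+ k ℤ.+ + j) ≡ + s
  slack-ℤ = begin
    + suc j ℤ.* + (5 + a) ℤ.- + (k + j)    ≡⟨ cong (ℤ._- + (k + j)) (ℤₚ.pos-* (suc j) (5 + a)) ⟨
    + (suc j * (5 + a)) ℤ.- + (k + j)      ≡⟨ cong (λ m → + m ℤ.- + (k + j)) slack ⟨
    + (k + j) ℤ.+ + s ℤ.- + (k + j)        ≡⟨ cancel (+ (k + j)) (+ s) ⟩
    + s                                    ∎
    where
    open ≡-Reasoning
    cancel : ∀ x y → x ℤ.+ y ℤ.- x ≡ y
    cancel = ℤ-Ring.solve-∀

  -- The right side exceeds the left by `4aj + 4s`, where `a = t - 6` is nonnegative.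
  bound1 : Bound1 (6 + a) (k + j) (suc k)
  bound1 = subst (lhs ℤ.≤_) (≡-sym rhs≡) (ℤₚ.i≤i+j lhs (+ (4 * a * j + 4 * s)))
    where
    lhs rhs : ℤ.ℤ
    lhs = (+ 2 ℤ.* (+ 4 ℤ.* + (6 + a) ℤ.- + 14)) ℤ.* + suc k
    rhs = (+ 2 ℤ.* (+ 4 ℤ.* + (6 + a) ℤ.- + 14)) ℤ.* + (k + j)
      ℤ.- + 2 ℤ.* (+ 2 ℤ.* + (k + j) ℤ.- + 5) ℤ.+ + 3 ℤ.* (+ 4 ℤ.* + (6 + a) ℤ.- + 14)
    identity : ∀ A J K →
      (+ 2 ℤ.* (+ 4 ℤ.* (+ 6 ℤ.+ A) ℤ.- + 14)) ℤ.* (K ℤ.+ J)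
        ℤ.- + 2 ℤ.* (+ 2 ℤ.* (K ℤ.+ J) ℤ.- + 5) ℤ.+ + 3 ℤ.* (+ 4 ℤ.* (+ 6 ℤ.+ A) ℤ.- + 14)
      ≡ (+ 2 ℤ.* (+ 4 ℤ.* (+ 6 ℤ.+ A) ℤ.- + 14)) ℤ.* (+ 1 ℤ.+ K)
        ℤ.+ (+ 4 ℤ.* A ℤ.* J ℤ.+ + 4 ℤ.* ((+ 1 ℤ.+ J) ℤ.* (+ 5 ℤ.+ A) ℤ.- (K ℤ.+ J)))
    identity = ℤ-Ring.solve-∀
    rhs≡ : rhs ≡ lhs ℤ.+ + (4 * a * j + 4 * s)
    rhs≡ = begin
      rhs  ≡⟨ identity (+ a) (+ j) (+ k) ⟩
      _    ≡⟨ cong (λ z → lhs ℤ.+ (+ 4 ℤ.* + a ℤ.* + j ℤ.+ + 4 ℤ.* z)) slack-ℤ ⟩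
      lhs ℤ.+ (+ 4 ℤ.* + a ℤ.* + j ℤ.+ + 4 ℤ.* + s)
           ≡⟨ cong (λ z → lhs ℤ.+ z) (cong₂ ℤ._+_ (trans (cong (ℤ._* + j) (≡-sym (ℤₚ.pos-* 4 a))) (≡-sym (ℤₚ.pos-* (4 * a) j))) (≡-sym (ℤₚ.pos-* 4 s))) ⟩
      lhs ℤ.+ + (4 * a * j + 4 * s)  ∎
      where open ≡-Reasoning

  -- Splitting 192 as 20 + 172 absorbs the term `172δ` into the slack: the quantity is
  -- `-(20(j + 1)(t - 1) + 172s)`, so the first alternative holds.
  bound2 : Bound2 (6 + a) (k + j) (suc k)
  bound2 = inj₁ (subst (ℤ._≤ + 0) (≡-sym A≡) ℤₚ.neg-≤-pos)
    where
    identity : ∀ A J K →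
      + 192 ℤ.* (+ 6 ℤ.+ A ℤ.- + 1) ℤ.* (+ 1 ℤ.+ K ℤ.- + 2 ℤ.- (K ℤ.+ J)) ℤ.+ + 172 ℤ.* (K ℤ.+ J)
      ≡ ℤ.- (+ 20 ℤ.* ((+ 1 ℤ.+ J) ℤ.* (+ 5 ℤ.+ A))
             ℤ.+ + 172 ℤ.* ((+ 1 ℤ.+ J) ℤ.* (+ 5 ℤ.+ A) ℤ.- (K ℤ.+ J)))
    identity = ℤ-Ring.solve-∀
    A≡ : Bound2A (6 + a) (k + j) (suc k) ≡ ℤ.- + (20 * (suc j * (5 + a)) + 172 * s)
    A≡ = begin
      Bound2A (6 + a) (k + j) (suc k)  ≡⟨ identity (+ a) (+ j) (+ k) ⟩
      _  ≡⟨ cong (λ z → ℤ.- (+ 20 ℤ.* (+ suc j ℤ.* + (5 + a)) ℤ.+ + 172 ℤ.* z)) slack-ℤ ⟩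
      ℤ.- (+ 20 ℤ.* (+ suc j ℤ.* + (5 + a)) ℤ.+ + 172 ℤ.* + s)
         ≡⟨ cong ℤ.-_ (cong₂ ℤ._+_ (trans (cong (+ 20 ℤ.*_) (≡-sym (ℤₚ.pos-* (suc j) (5 + a)))) (≡-sym (ℤₚ.pos-* 20 (suc j * (5 + a))))) (≡-sym (ℤₚ.pos-* 172 s))) ⟩
      ℤ.- + (20 * (suc j * (5 + a)) + 172 * s)  ∎
      where open ≡-Reasoning

theorem3 : (t δ : ℕ) → 6 ≤ t →
    (∀ (n : ℕ) (H : Graph (suc n)) → KMinorFree H (suc t) → ∃[ v ] degree H v ≤ δ) →
    ∀ (n : ℕ) (G : Graph n) → KMinorFree G (suc t) →
    ∃[ k ] (Colourable G k × Bound1 t δ k × Bound2 t δ k)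
theorem3 t δ 6≤t low-degree n G free with a , refl ← m≤n⇒∃[o]m+o≡n 6≤t =
  -- The parameter is `t - 3`, as `colourable` excludes a clique minor four larger than its own
  -- parameter.
  suc q , colourable (3 + a) j q j-bound low-degree′ n G free
        , subst (λ δ → Bound1 (6 + a) δ (suc q)) q+j≡δ (bound1 a j gap q slack)
        , subst (λ δ → Bound2 (6 + a) δ (suc q)) q+j≡δ (bound2 a j gap q slack)
  where
  d j q gap : ℕ
  d = 5 + a
  -- For `δ ≥ 1` the shift by one makes `j` the largest integer with `j * d < δ`; then
  -- `δ ≤ suc j * d`, so the subtraction in `gap` is exact.
  j = (δ ∸ 1) / d
  q = δ ∸ j
  gap = suc j * d ∸ δ
  q+j≡δ : q + j ≡ δ
  q+j≡δ = m∸n+n≡m (≤-trans (m/n≤m (δ ∸ 1) d) (m∸n≤m δ 1))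
  low-degree′ : ∀ n (H : Graph (suc n)) → KMinorFree H (suc (6 + a)) → ∃[ v ] degree H v ≤ q + j
  low-degree′ n H free with v , deg ← low-degree n H free = v , subst (degree H v ≤_) (≡-sym q+j≡δ) deg
  j-bound : 1 ≤ j → j * d < q + j
  j-bound 1≤j = subst (j * d <_) (≡-sym q+j≡δ) (begin-strict
    j * d    ≤⟨ m/n*n≤m (δ ∸ 1) d ⟩
    δ ∸ 1    <⟨ ∸-monoʳ-< z<s (≤-trans 1≤j (≤-trans (m/n≤m (δ ∸ 1) d) (m∸n≤m δ 1))) ⟩
    δ        ∎)
    where open ≤-Reasoning
  slack : q + j + gap ≡ suc j * d
  slack = trans (cong (_+ gap) q+j≡δ) (m+[n∸m]≡n (begin
    δ                            ≤⟨ m≤n+m∸n δ 1 ⟩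
    suc (δ ∸ 1)                  ≡⟨ cong suc (m≡m%n+[m/n]*n (δ ∸ 1) d) ⟩
    suc ((δ ∸ 1) % d) + j * d    ≤⟨ +-monoˡ-≤ (j * d) (m%n<n (δ ∸ 1) d) ⟩
    suc j * d                    ∎))
    where open ≤-Reasoning
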